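{- Let $P_n$, $C_n$ denote the path and the cycle on $n$ vertices, and $K_{1,n}$ the star on $n+1$ vertices. Then: (i) for every $n\ge 4$, $\widetilde{D}(P_n,x)=x^{n-2}(x^2+nx+n-3)$; (ii) for every $n\ge 3$, $\widetilde{D}(C_n,x)=x^{n-2}(x^2+nx+n)$; (iii) for every integer $n\ge 1$, $\widetilde{D}(K_{1,n},x)=x^n(n+x+1)$. Here $\widetilde{D}$ denotes the outer-connected domination polynomial.
   Context: All graphs are finite, simple, and have nonempty vertex set. A set $S\subseteq V(G)$ is a dominating set of $G$ if every vertex of $V(G)\setminus S$ is adjacent to at least one vertex of $S$. A set $S\subseteq V(G)$ is an outer-connected dominating set (ocd-set) of $G$ if $S$ is a dominating set of $G$ and either $S=V(G)$ or the subgraph of $G$ induced by $V(G)\setminus S$ is connected. The outer-connected domination number $\widetilde{\gamma}_c(G)$ is the minimum cardinality of an ocd-set of $G$. Let $\widetilde{d}(G,i)$ be the number of ocd-sets of $G$ of cardinality $i$. The outer-connected domination polynomial of $G$ is $\widetilde{D}(G,x)=\sum_{i=\widetilde{\gamma}_c(G)}^{|V(G)|}\widetilde{d}(G,i)\,x^i$. -}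

module Defs where

import Data.Bool.Properties as Bool
open import Data.Empty using (⊥)
open import Data.Fin.Base using (Fin; zero; suc; toℕ)
open import Data.Fin.Properties using (any?; all?)
open import Data.Fin.Subset as Subset
  using (Subset; inside; outside; _∈_; _∉_; ∁; _∪_; ⁅_⁆; ∣_∣; _⊃_; Nonempty)
open import Data.Fin.Subset.Induction using (⊃-wellFounded; Acc; acc)
open import Data.Fin.Subset.Properties
  using (_∈?_; nonempty?; x∈⁅x⁆; x∈⁅y⁆⇒x≡y; p⊆p∪q; q⊆p∪q; x∈p∪q⁻)
open import Data.Integer.Base as ℤ using (ℤ; +_)
open import Data.List.Base using (List; []; _∷_; _++_; map; filter; foldr; length; upTo)
open import Data.List.Extrema.Nat using (min)
open import Data.Nat.Base as ℕ using (ℕ; zero; suc; _∸_; _≤_; s≤s; NonZero)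
import Data.Nat.Properties as ℕ
open import Data.Product.Base using (_×_; _,_; ∃)
open import Data.Sum.Base using (_⊎_; inj₁; inj₂; swap; [_,_]′)
open import Data.Unit.Base using (⊤; tt)
open import Data.Vec.Base using ([]; _∷_)
open import Data.Vec.Properties using (≡-dec)
open import Relation.Binary.Construct.Closure.ReflexiveTransitive
  using (Star; ε; _◅_; _◅◅_)
open import Relation.Binary.Core using (Rel)
import Relation.Binary.Definitions as B
open import Relation.Binary.PropositionalEquality.Core using (_≡_; refl; sym; trans; cong; subst)
open import Relation.Nullary.Decidable.Core
  using (Dec; yes; no; ¬?; _×-dec_; _⊎-dec_; _→-dec_)
open import Relation.Nullary.Negation.Core using (¬_; contradiction)
open import Level using (0ℓ)

record Graph (n : ℕ) : Set₁ where
  field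
    .nonempty : NonZero n
    Adj       : Rel (Fin n) 0ℓ
    Adj?      : B.Decidable Adj
    Adj-sym   : B.Symmetric Adj
    Adj-irr   : ∀ {u} → ¬ Adj u u

module _ {n} {R : Rel (Fin n) 0ℓ} (R? : B.Decidable R) where

  private
    closed⇒∈ : ∀ {T : Subset n} → (∀ {a b} → a ∈ T → R a b → b ∈ T) →
               ∀ {u v} → u ∈ T → Star R u v → v ∈ T
    closed⇒∈ cl u∈T ε         = u∈T
    closed⇒∈ cl u∈T (r ◅ rs) = closed⇒∈ cl (cl u∈T r) rs

    -- T is a set of vertices known to be reachable from u; enlarge it
    -- until it is closed under R.
    grow : ∀ {u} (T : Subset n) → Acc _⊃_ T → u ∈ T →
           (∀ {v} → v ∈ T → Star R u v) → ∀ v → Dec (Star R u v)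
    grow T (acc rec) u∈T reach v
      with any? (λ a → any? (λ b → (a ∈? T) ×-dec ¬? (b ∈? T) ×-dec R? a b))
    ... | yes (a , b , a∈T , b∉T , ab) =
          grow (T ∪ ⁅ b ⁆)
               (rec (p⊆p∪q ⁅ b ⁆ , b , q⊆p∪q T ⁅ b ⁆ (x∈⁅x⁆ b) , b∉T))
               (p⊆p∪q ⁅ b ⁆ u∈T) reach′ v
      where
      reach′ : ∀ {w} → w ∈ T ∪ ⁅ b ⁆ → Star R _ w
      reach′ w∈ with x∈p∪q⁻ T ⁅ b ⁆ w∈
      ... | inj₁ w∈T = reach w∈T
      ... | inj₂ w∈b with refl ← x∈⁅y⁆⇒x≡y b w∈b = reach a∈T ◅◅ (ab ◅ ε)
    ... | no stuck with v ∈? T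
    ...   | yes v∈T = yes (reach v∈T)
    ...   | no  v∉T = no λ rs → v∉T (closed⇒∈ cl u∈T rs)
      where
      cl : ∀ {a b} → a ∈ T → R a b → b ∈ T
      cl {a} {b} a∈T ab with b ∈? T
      ... | yes b∈T = b∈T
      ... | no  b∉T = contradiction (a , b , a∈T , b∉T , ab) stuck

  star? : B.Decidable (Star R)
  star? u = grow ⁅ u ⁆ (⊃-wellFounded ⁅ u ⁆) (x∈⁅x⁆ u) reach
    where
    reach : ∀ {v} → v ∈ ⁅ u ⁆ → Star R u v
    reach v∈ with refl ← x∈⁅y⁆⇒x≡y u v∈ = ε

allSubsets : ∀ n → List (Subset n)
allSubsets zero    = [] ∷ []
allSubsets (suc n) = map (inside ∷_) (allSubsets n) ++ map (outside ∷_) (allSubsets n)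

module _ {n} (G : Graph n) where
  open Graph G

  Dominating : Subset n → Set
  Dominating S = ∀ v → v ∉ S → ∃ λ u → u ∈ S × Adj v u

  InducedAdj : Subset n → Rel (Fin n) 0ℓ
  InducedAdj T u v = u ∈ T × v ∈ T × Adj u v

  -- The subgraph induced by T is connected.  As graphs are nonempty,
  -- the empty set does not induce a connected subgraph.
  InducedConnected : Subset n → Set
  InducedConnected T =
    Nonempty T × (∀ u v → u ∈ T → v ∈ T → Star (InducedAdj T) u v)

  IsOCD : Subset n → Set
  IsOCD S = Dominating S × (S ≡ Subset.⊤ ⊎ InducedConnected (∁ S))

  dominating? : ∀ S → Dec (Dominating S)
  dominating? S =
    all? λ v → ¬? (v ∈? S) →-dec any? λ u → (u ∈? S) ×-dec Adj? v u

  inducedAdj? : ∀ T → B.Decidable (InducedAdj T)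
  inducedAdj? T u v = (u ∈? T) ×-dec (v ∈? T) ×-dec Adj? u v

  inducedConnected? : ∀ T → Dec (InducedConnected T)
  inducedConnected? T = nonempty? T ×-dec
    all? λ u → all? λ v → (u ∈? T) →-dec ((v ∈? T) →-dec star? (inducedAdj? T) u v)

  isOCD? : ∀ S → Dec (IsOCD S)
  isOCD? S = dominating? S ×-dec
    (≡-dec Bool._≟_ S Subset.⊤ ⊎-dec inducedConnected? (∁ S))

  ocdSets : List (Subset n)
  ocdSets = filter isOCD? (allSubsets n)

  -- The default value n is the cardinality of the ocd-set V(G), so this
  -- is the minimum over the (nonempty) list of ocd-sets.
  γ̃c : ℕ
  γ̃c = min n (map ∣_∣ ocdSets)

  d̃ : ℕ → ℕ
  d̃ i = length (filter (λ S → ∣ S ∣ ℕ.≟ i) ocdSets)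

-- Polynomials over ℤ as coefficient lists, constant term first.
-- Trailing zeros are allowed, so equality is _≈ₚ_ rather than _≡_.

Poly : Set
Poly = List ℤ

coeff : Poly → ℕ → ℤ
coeff []      _       = + 0
coeff (a ∷ p) zero    = a
coeff (a ∷ p) (suc k) = coeff p k

infix  4 _≈ₚ_
infixl 6 _+ₚ_
infixl 7 _*ₚ_
infixr 8 _^ₚ_

_≈ₚ_ : Rel Poly 0ℓ
p ≈ₚ q = ∀ k → coeff p k ≡ coeff q k

const : ℤ → Poly
const a = a ∷ []

X : Poly
X = + 0 ∷ + 1 ∷ []

_+ₚ_ : Poly → Poly → Poly
[]      +ₚ q       = q
(a ∷ p) +ₚ []      = a ∷ p
(a ∷ p) +ₚ (b ∷ q) = (a ℤ.+ b) ∷ (p +ₚ q)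

_*ₚ_ : Poly → Poly → Poly
[]      *ₚ q = []
(a ∷ p) *ₚ q = map (a ℤ.*_) q +ₚ (+ 0 ∷ p *ₚ q)

_^ₚ_ : Poly → ℕ → Poly
p ^ₚ zero  = const (+ 1)
p ^ₚ suc k = p *ₚ p ^ₚ k

∑[_≤i≤_]_ : ℕ → ℕ → (ℕ → Poly) → Poly
∑[ a ≤i≤ b ] f = foldr _+ₚ_ [] (map (λ j → f (a ℕ.+ j)) (upTo (suc b ∸ a)))

D̃ : ∀ {n} → Graph n → Poly
D̃ {n} G = ∑[ γ̃c G ≤i≤ n ] λ i → const (+ d̃ G i) *ₚ X ^ₚ i

PathSucc CycleSucc : ∀ {n} → Rel (Fin n) 0ℓ
PathSucc      i j = toℕ j ≡ suc (toℕ i)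
CycleSucc {n} i j = PathSucc i j ⊎ (suc (toℕ i) ≡ n × toℕ j ≡ 0)

private
  m≢1+m : ∀ {m : ℕ} → ¬ (m ≡ suc m)
  m≢1+m ()

pathGraph : ∀ n → .{{NonZero n}} → Graph n
pathGraph n {{n≢0}} = record
  { nonempty = n≢0
  ; Adj      = λ i j → PathSucc i j ⊎ PathSucc j i
  ; Adj?     = λ i j → (toℕ j ℕ.≟ suc (toℕ i)) ⊎-dec (toℕ i ℕ.≟ suc (toℕ j))
  ; Adj-sym  = swap
  ; Adj-irr  = [ m≢1+m , m≢1+m ]′
  }

cycleGraph : ∀ n → 3 ≤ n → Graph n
cycleGraph n 3≤n = record
  { nonempty = ℕ.>-nonZero (ℕ.≤-trans (s≤s ℕ.z≤n) 3≤n)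
  ; Adj      = λ i j → CycleSucc i j ⊎ CycleSucc j i
  ; Adj?     = λ i j → succ? i j ⊎-dec succ? j i
  ; Adj-sym  = swap
  ; Adj-irr  = [ irr , irr ]′
  }
  where
  succ? : B.Decidable (CycleSucc {n})
  succ? i j = (toℕ j ℕ.≟ suc (toℕ i)) ⊎-dec ((suc (toℕ i) ℕ.≟ n) ×-dec (toℕ j ℕ.≟ 0))

  irr : ∀ {i} → ¬ CycleSucc {n} i i
  irr (inj₁ eq) = m≢1+m eq
  irr (inj₂ (1+i≡n , i≡0)) with subst (3 ≤_) (trans (sym 1+i≡n) (cong suc i≡0)) 3≤n
  ... | s≤s ()

-- K₁,ₙ with centre zero
StarAdj : ∀ {n} → Rel (Fin (suc n)) 0ℓ
StarAdj zero    zero    = ⊥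
StarAdj zero    (suc _) = ⊤
StarAdj (suc _) zero    = ⊤
StarAdj (suc _) (suc _) = ⊥

starGraph : ∀ n → Graph (suc n)
starGraph n = record
  { nonempty = record { nonZero = tt }
  ; Adj      = StarAdj
  ; Adj?     = adj?
  ; Adj-sym  = λ {i} {j} → adj-sym i j
  ; Adj-irr  = λ {i} → irr i
  }
  where
  adj? : B.Decidable (StarAdj {n})
  adj? zero    zero    = no λ ()
  adj? zero    (suc _) = yes tt
  adj? (suc _) zero    = yes tt
  adj? (suc _) (suc _) = no λ ()

  adj-sym : ∀ (i j : Fin (suc n)) → StarAdj i j → StarAdj j i
  adj-sym zero    (suc _) _ = tt
  adj-sym (suc _) zero    _ = tt

  irr : ∀ (i : Fin (suc n)) → ¬ StarAdj i i
  irr zero    ()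
  irr (suc _) ()

{-# OPTIONS --safe #-}
module Submission where

-- Let S be an ocd-set of a path or a cycle, with complement T ≠ ∅.  A vertex
-- of T has degree at most 2 and a neighbour in S, hence at most one neighbour
-- in T, so the connected graph induced by T is a single vertex or a single
-- edge.  In a star, T cannot even contain an edge: a leaf in T is dominated by
-- the centre.  As no vertex is isolated, V(G) and all its subsets omitting one
-- vertex are ocd-sets, and it remains to count the edges both of whose ends
-- have another neighbour: n − 3 in Pₙ, n in Cₙ, and none in K₁,ₙ.

open import Defs
import Algebra.Lattice.Properties.BooleanAlgebra as BooleanAlgebra
open import Data.Fin.Base using (Fin; zero; suc; toℕ; fromℕ; fromℕ<; inject₁)
open import Data.Fin.Properties
  using (any?; suc-injective; inject₁-injective; toℕ-injective; toℕ-inject₁; toℕ-fromℕ; toℕ-fromℕ<; toℕ<n)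
open import Data.Fin.Subset as Subset
  using (Subset; inside; outside; _∈_; _∉_; ∁; _∪_; ⁅_⁆; ∣_∣)
open import Data.Fin.Subset.Properties
open import Data.Integer.Base as ℤ using (ℤ; +_; _-_)
import Data.Integer.Properties as ℤ
open import Data.List.Base using (List; []; _∷_; _++_; [_]; map; filter; foldr; length; upTo; replicate; allFin)
open import Data.List.Extrema.Nat using (min≤v⁺)
import Data.List.Membership.Propositional as List
open import Data.List.Membership.Propositional.Properties
  using (∈-map⁺; ∈-map⁻; ∈-++⁺ˡ; ∈-++⁺ʳ; ∈-filter⁺; ∈-filter⁻; ∈-upTo⁺; ∈-allFin)
open import Data.List.Membership.Propositional.Properties.WithK using (unique∧set⇒bag)
open import Data.List.Properties using (length-map; length-tabulate; map-∘; map-cong; map-id)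
open import Data.List.Relation.Binary.BagAndSetEquality using (∼bag⇒↭)
open import Data.List.Relation.Binary.Permutation.Propositional.Properties using (↭-length)
open import Data.List.Relation.Unary.All as All using ([]; _∷_)
open import Data.List.Relation.Unary.Any as Any using (here; there)
open import Data.List.Relation.Unary.Unique.Propositional using (Unique; []; _∷_)
import Data.List.Relation.Unary.Unique.Propositional.Properties as Unique
open import Data.Nat.Base as ℕ using (ℕ; zero; suc; 2+; _∸_; _≤_; _<_; z≤n; s≤s; NonZero)
import Data.Nat.Properties as ℕ
open import Data.Product.Base using (_×_; _,_; ∃; proj₁; proj₂)
open import Data.Sum.Base using (_⊎_; inj₁; inj₂; [_,_]′)
open import Data.Unit.Base using (tt)
import Data.Vec.Base as Vec
open import Data.Vec.Properties using (∷-injectiveʳ)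
open import Function.Base using (_∘_; id)
open import Function.Bundles using (mk⇔)
open import Relation.Binary.Construct.Closure.ReflexiveTransitive using (Star; ε; _◅_)
open import Relation.Binary.Core using (Rel)
open import Relation.Binary.PropositionalEquality
  using (_≡_; _≢_; refl; sym; trans; cong; cong₂; subst; module ≡-Reasoning)
open import Relation.Nullary.Decidable.Core using (yes; no)
open import Relation.Nullary.Negation.Core using (¬_; contradiction)
open import Level using (0ℓ)

private variable
  n k m c : ℕ

-- Coefficients of polynomials

coeff-+ₚ : ∀ p q k → coeff (p +ₚ q) k ≡ coeff p k ℤ.+ coeff q k
coeff-+ₚ []      q       k       = sym (ℤ.+-identityˡ _)
coeff-+ₚ (a ∷ p) []      k       = sym (ℤ.+-identityʳ _)
coeff-+ₚ (a ∷ p) (b ∷ q) zero    = refl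
coeff-+ₚ (a ∷ p) (b ∷ q) (suc k) = coeff-+ₚ p q k

coeff-map-* : ∀ a p k → coeff (map (a ℤ.*_) p) k ≡ a ℤ.* coeff p k
coeff-map-* a []      k       = sym (ℤ.*-zeroʳ a)
coeff-map-* a (b ∷ p) zero    = refl
coeff-map-* a (b ∷ p) (suc k) = coeff-map-* a p k

coeff-const-*ₚ : ∀ a p k → coeff (const a *ₚ p) k ≡ a ℤ.* coeff p k
coeff-const-*ₚ a p k = begin
  coeff (map (a ℤ.*_) p +ₚ const (+ 0)) k            ≡⟨ coeff-+ₚ (map (a ℤ.*_) p) _ k ⟩
  coeff (map (a ℤ.*_) p) k ℤ.+ coeff (const (+ 0)) k ≡⟨ cong₂ ℤ._+_ (coeff-map-* a p k) (coeff-0 k) ⟩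
  a ℤ.* coeff p k ℤ.+ + 0                            ≡⟨ ℤ.+-identityʳ _ ⟩
  a ℤ.* coeff p k                                    ∎
  where
  open ≡-Reasoning
  coeff-0 : ∀ k → coeff (const (+ 0)) k ≡ + 0
  coeff-0 zero    = refl
  coeff-0 (suc k) = refl

∷-*ₚ : ∀ p q → (+ 0 ∷ p) *ₚ q ≈ₚ + 0 ∷ p *ₚ q
∷-*ₚ p q k = begin
  coeff (map (+ 0 ℤ.*_) q +ₚ (+ 0 ∷ p *ₚ q)) k               ≡⟨ coeff-+ₚ (map (+ 0 ℤ.*_) q) _ k ⟩
  coeff (map (+ 0 ℤ.*_) q) k ℤ.+ coeff (+ 0 ∷ p *ₚ q) k      ≡⟨ cong (ℤ._+ coeff (+ 0 ∷ p *ₚ q) k) (coeff-map-* (+ 0) q k) ⟩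
  + 0 ℤ.+ coeff (+ 0 ∷ p *ₚ q) k                             ≡⟨ ℤ.+-identityˡ _ ⟩
  coeff (+ 0 ∷ p *ₚ q) k                                     ∎
  where open ≡-Reasoning

-- Multiplication by the `m`-th power of `X` on coefficient lists, in a form that leaves no sums
-- with zero to simplify.
shift : ℕ → Poly → Poly
shift m p = replicate m (+ 0) ++ p

shift-cong : ∀ m {p q} → p ≈ₚ q → shift m p ≈ₚ shift m q
shift-cong zero    p≈q k       = p≈q k
shift-cong (suc m) p≈q zero    = refl
shift-cong (suc m) p≈q (suc k) = shift-cong m p≈q k

shift-suc : ∀ m p → shift (suc m) p ≡ shift m (+ 0 ∷ p)
shift-suc zero    p = refl
shift-suc (suc m) p = cong (+ 0 ∷_) (shift-suc m p)

-- For a nonempty list the two sides agree even as lists; multiplying `[]` by `X` would instead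
-- leave an additional trailing zero.
X*∷ : ∀ a p → X *ₚ (a ∷ p) ≡ + 0 ∷ a ∷ p
X*∷ a p = cong₂ _∷_ refl (trans (cong₂ _+ₚ_ {x = map (+ 0 ℤ.*_) p} refl 1*) (0*-+ a p))
  where
  0*-+ : ∀ a p → map (+ 0 ℤ.*_) p +ₚ (a ∷ p) ≡ a ∷ p
  0*-+ a []      = refl
  0*-+ a (b ∷ p) = cong₂ _∷_ (ℤ.+-identityˡ a) (0*-+ b p)

  +ₚ-[] : ∀ p → p +ₚ [] ≡ p
  +ₚ-[] []      = refl
  +ₚ-[] (_ ∷ _) = refl

  1* : map (+ 1 ℤ.*_) (a ∷ p) +ₚ const (+ 0) ≡ a ∷ p
  1* = cong₂ _∷_ (trans (ℤ.+-identityʳ _) (ℤ.*-identityˡ a))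
                 (trans (+ₚ-[] _) (trans (map-cong ℤ.*-identityˡ p) (map-id p)))

X^≡shift : ∀ m → X ^ₚ m ≡ shift m [ + 1 ]
X^≡shift zero          = refl
X^≡shift (suc zero)    = refl
-- After the rewriting, the second factor is `shift (suc m) [ + 1 ]`, which begins with a visible
-- zero, so `X*∷` applies.
X^≡shift (suc (suc m)) rewrite X^≡shift (suc m) = X*∷ _ _

shift-*ₚ : ∀ m p q → shift m p *ₚ q ≈ₚ shift m (p *ₚ q)
shift-*ₚ zero    p q k       = refl
shift-*ₚ (suc m) p q zero    = ∷-*ₚ (shift m p) q zero
shift-*ₚ (suc m) p q (suc k) = trans (∷-*ₚ (shift m p) q (suc k)) (shift-*ₚ m p q k)

X^-*ₚ : ∀ m q → X ^ₚ m *ₚ q ≈ₚ shift m q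
X^-*ₚ m q k rewrite X^≡shift m = trans (shift-*ₚ m [ + 1 ] q k) (shift-cong m 1*q k)
  where
  1*q : [ + 1 ] *ₚ q ≈ₚ q
  1*q k = trans (coeff-const-*ₚ (+ 1) q k) (ℤ.*-identityˡ _)

-- Unification would unfold D̃ in order to infer p and q, so they are explicit.
factor : ∀ m p q r → p ≈ₚ shift m r → q ≈ₚ r → p ≈ₚ X ^ₚ m *ₚ q
factor m p q r p≈ q≈r k = trans (p≈ k) (sym (trans (X^-*ₚ m q k) (shift-cong m q≈r k)))

coeff-X^ : ∀ k → coeff (X ^ₚ k) k ≡ + 1
coeff-X^ k rewrite X^≡shift k = go k
  where
  go : ∀ k → coeff (shift k [ + 1 ]) k ≡ + 1
  go zero    = refl
  go (suc k) = go k

coeff-X^-≢ : ∀ {i k} → i ≢ k → coeff (X ^ₚ i) k ≡ + 0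
coeff-X^-≢ {i} {k} i≢k rewrite X^≡shift i = go i k i≢k
  where
  go : ∀ i k → i ≢ k → coeff (shift i [ + 1 ]) k ≡ + 0
  go zero    zero    0≢0 = contradiction refl 0≢0
  go zero    (suc k) _   = refl
  go (suc i) zero    _   = refl
  go (suc i) (suc k) i≢k = go i k (i≢k ∘ cong suc)

module _ (d : ℕ → ℕ) where

  private
    term : ℕ → Poly
    term i = const (+ d i) *ₚ X ^ₚ i

    coeff-term : ∀ k → coeff (term k) k ≡ + d k
    coeff-term k = trans (coeff-const-*ₚ (+ d k) (X ^ₚ k) k)
      (trans (cong (+ d k ℤ.*_) (coeff-X^ k)) (ℤ.*-identityʳ _))

    coeff-term-≢ : ∀ {i k} → i ≢ k → coeff (term i) k ≡ + 0
    coeff-term-≢ {i} {k} i≢k = trans (coeff-const-*ₚ (+ d i) (X ^ₚ i) k)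
      (trans (cong (+ d i ℤ.*_) (coeff-X^-≢ i≢k)) (ℤ.*-zeroʳ (+ d i)))

    sumₚ : List ℕ → Poly
    sumₚ is = foldr _+ₚ_ [] (map term is)

    coeff-sum-∉ : ∀ {is k} → k List.∉ is → coeff (sumₚ is) k ≡ + 0
    coeff-sum-∉ {[]}         _   = refl
    coeff-sum-∉ {i ∷ is} {k} k∉ = trans (coeff-+ₚ (term i) (sumₚ is) k)
      (cong₂ ℤ._+_ (coeff-term-≢ (k∉ ∘ here ∘ sym)) (coeff-sum-∉ (k∉ ∘ there)))

    coeff-sum-∈ : ∀ {is k} → Unique is → k List.∈ is → coeff (sumₚ is) k ≡ + d k
    coeff-sum-∈ {i ∷ is} {k} (i∉ ∷ _) (here refl) = trans (coeff-+ₚ (term i) (sumₚ is) k)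
      (trans (cong₂ ℤ._+_ (coeff-term k) (coeff-sum-∉ λ k∈ → All.lookup i∉ k∈ refl)) (ℤ.+-identityʳ _))
    coeff-sum-∈ {i ∷ is} {k} (i∉ ∷ u) (there k∈)  = trans (coeff-+ₚ (term i) (sumₚ is) k)
      (trans (cong₂ ℤ._+_ (coeff-term-≢ (All.lookup i∉ k∈)) (coeff-sum-∈ u k∈)) (ℤ.+-identityˡ _))

  -- The indices are distinct, so at most one term reaches coefficient `k`. If `k` is not an index,
  -- no term does, and `d k` is zero by the support condition.
  coeff-∑ : ∀ {a b} → (∀ {k} → d k ≢ 0 → a ≤ k × k ≤ b) →
            ∀ k → coeff (∑[ a ≤i≤ b ] term) k ≡ + d k
  coeff-∑ {a} {b} supp k
    -- Reindexing: `term` is now mapped over the list of the actual indices `a + j`, to which the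
    -- lemmas on `sumₚ` apply.
    rewrite map-∘ {g = term} {f = a ℕ.+_} (upTo (suc b ∸ a)) with d k ℕ.≟ 0
  ... | no dk≢0 = coeff-sum-∈
          (Unique.map⁺ (ℕ.+-cancelˡ-≡ a _ _) (Unique.upTo⁺ (suc b ∸ a))) (k∈ (supp dk≢0))
    where
    k∈ : a ≤ k × k ≤ b → k List.∈ map (a ℕ.+_) (upTo (suc b ∸ a))
    k∈ (a≤k , k≤b) = subst (List._∈ _) (ℕ.m+[n∸m]≡n a≤k)
      (∈-map⁺ (a ℕ.+_) (∈-upTo⁺ (ℕ.∸-monoˡ-< (s≤s k≤b) a≤k)))
  ... | yes dk≡0 with Any.any? (k ℕ.≟_) (map (a ℕ.+_) (upTo (suc b ∸ a)))
  ...   | yes k∈ = coeff-sum-∈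
          (Unique.map⁺ (ℕ.+-cancelˡ-≡ a _ _) (Unique.upTo⁺ (suc b ∸ a))) k∈
  ...   | no  k∉ = trans (coeff-sum-∉ k∉) (cong +_ (sym dk≡0))

-- The set of all subsets, and counting by enumeration

∈-allSubsets : (S : Subset n) → S List.∈ allSubsets n
∈-allSubsets Vec.[]            = here refl
∈-allSubsets (inside  Vec.∷ S) = ∈-++⁺ˡ (∈-map⁺ (inside Vec.∷_) (∈-allSubsets S))
∈-allSubsets (outside Vec.∷ S) = ∈-++⁺ʳ _ (∈-map⁺ (outside Vec.∷_) (∈-allSubsets S))

allSubsets-unique : ∀ n → Unique (allSubsets n)
allSubsets-unique zero    = [] ∷ []
allSubsets-unique (suc n) = Unique.++⁺
  (Unique.map⁺ ∷-injectiveʳ (allSubsets-unique n))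
  (Unique.map⁺ ∷-injectiveʳ (allSubsets-unique n))
  λ (S∈ , S∈′) → inside≢outside (∈-map⁻ _ S∈) (∈-map⁻ _ S∈′)
  where
  inside≢outside : ∀ {S : Subset (suc n)} →
    (∃ λ T → T List.∈ allSubsets n × S ≡ inside Vec.∷ T) →
    ¬ (∃ λ T → T List.∈ allSubsets n × S ≡ outside Vec.∷ T)
  inside≢outside (_ , _ , refl) (_ , _ , ())

module _ (G : Graph n) where

  private
    sizeIs : ∀ k (S : Subset n) → _
    sizeIs k S = ∣ S ∣ ℕ.≟ k

  -- The filtered list of ocd-sets and the list of the values of `f` are both free of duplicates and
  -- have the same members. They are therefore permutations of each other and have equal length.
  d̃-enumeration : (f : Fin c → Subset n) → (∀ {i j} → f i ≡ f j → i ≡ j) →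
    (∀ i → IsOCD G (f i)) → (∀ i → ∣ f i ∣ ≡ k) →
    (∀ {S} → IsOCD G S → ∣ S ∣ ≡ k → ∃ λ i → S ≡ f i) →
    d̃ G k ≡ c
  d̃-enumeration {c} {k} f f-inj ocd size complete = begin
    length (filter (sizeIs k) (ocdSets G)) ≡⟨ ↭-length (∼bag⇒↭ (unique∧set⇒bag
      (Unique.filter⁺ (sizeIs k) (Unique.filter⁺ (isOCD? G) (allSubsets-unique n)))
      (Unique.map⁺ f-inj (Unique.allFin⁺ c))
      (mk⇔ to from))) ⟩
    length (map f (allFin c))              ≡⟨ length-map f (allFin c) ⟩
    length (allFin c)                      ≡⟨ length-tabulate {n = c} id ⟩
    c                                      ∎
    where
    open ≡-Reasoning
    to : ∀ {S} → S List.∈ filter (sizeIs k) (ocdSets G) → S List.∈ map f (allFin c)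
    to S∈ with S∈ocd , ∣S∣≡k ← ∈-filter⁻ (sizeIs k) S∈
          with _ , S-ocd ← ∈-filter⁻ (isOCD? G) {xs = allSubsets n} S∈ocd
          with i , refl ← complete S-ocd ∣S∣≡k = ∈-map⁺ f (∈-allFin i)
    from : ∀ {S} → S List.∈ map f (allFin c) → S List.∈ filter (sizeIs k) (ocdSets G)
    from S∈ with i , _ , refl ← ∈-map⁻ f S∈ =
      ∈-filter⁺ (sizeIs k) (∈-filter⁺ (isOCD? G) (∈-allSubsets (f i)) (ocd i)) (size i)

  -- Every ocd-set has between `γ̃c G` and `n` elements, so the limits of summation cut off no
  -- nonzero coefficient.
  coeff-D̃ : ∀ k → coeff (D̃ G) k ≡ + d̃ G k
  coeff-D̃ = coeff-∑ (d̃ G) supp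
    where
    bounds : ∀ {S} → S List.∈ ocdSets G → γ̃c G ≤ ∣ S ∣ × ∣ S ∣ ≤ n
    bounds {S} S∈ =
      min≤v⁺ n _ (inj₂ (Any.map (ℕ.≤-reflexive ∘ sym) (∈-map⁺ ∣_∣ S∈))) , ∣p∣≤n S

    supp : ∀ {k} → d̃ G k ≢ 0 → γ̃c G ≤ k × k ≤ n
    -- A nonzero count means that the filtered list has a head, which is an ocd-set of size `k`.
    supp {k} d̃≢0 with filter (sizeIs k) (ocdSets G) in eq
    ... | []    = contradiction refl d̃≢0
    ... | S ∷ _ with S∈ , refl ← ∈-filter⁻ (sizeIs k) {xs = ocdSets G}
                                  (subst (S List.∈_) (sym eq) (here refl)) = bounds S∈

  d̃≡0 : (∀ {S} → IsOCD G S → ∣ S ∣ ≢ k) → d̃ G k ≡ 0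
  d̃≡0 none = d̃-enumeration (λ ()) (λ { {()} }) (λ ()) (λ ())
    λ S-ocd ∣S∣≡k → contradiction ∣S∣≡k (none S-ocd)

-- Sets missing at most two vertices

∁-involutive : (p : Subset n) → ∁ (∁ p) ≡ p
∁-involutive {n} = BooleanAlgebra.¬-involutive (∪-∩-booleanAlgebra n)

∁-injective : {p q : Subset n} → ∁ p ≡ ∁ q → p ≡ q
∁-injective {p = p} {q} ∁p≡∁q =
  trans (sym (∁-involutive p)) (trans (cong ∁ ∁p≡∁q) (∁-involutive q))

∣⁅x⁆∪p∣ : ∀ {x} {p : Subset n} → x ∉ p → ∣ ⁅ x ⁆ ∪ p ∣ ≡ suc ∣ p ∣
∣⁅x⁆∪p∣ {x = zero}  {outside Vec.∷ p} x∉p = cong (suc ∘ ∣_∣) (∪-identityˡ p)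
∣⁅x⁆∪p∣ {x = zero}  {inside  Vec.∷ p} x∉p = contradiction Vec.here x∉p
∣⁅x⁆∪p∣ {x = suc x} {outside Vec.∷ p} x∉p = ∣⁅x⁆∪p∣ (x∉p ∘ Vec.there)
∣⁅x⁆∪p∣ {x = suc x} {inside  Vec.∷ p} x∉p = cong suc (∣⁅x⁆∪p∣ (x∉p ∘ Vec.there))

∣∁⁅x⁆∣ : (x : Fin (suc n)) → ∣ ∁ ⁅ x ⁆ ∣ ≡ n
∣∁⁅x⁆∣ x = trans (∣∁p∣≡n∸∣p∣ ⁅ x ⁆) (cong (_ ∸_) (∣⁅x⁆∣≡1 x))

∣∁⁅x,y⁆∣ : ∀ {x y : Fin (2+ n)} → x ≢ y → ∣ ∁ (⁅ x ⁆ ∪ ⁅ y ⁆) ∣ ≡ n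
∣∁⁅x,y⁆∣ {x = x} {y} x≢y = trans (∣∁p∣≡n∸∣p∣ (⁅ x ⁆ ∪ ⁅ y ⁆))
  (cong (_ ∸_) (trans (∣⁅x⁆∪p∣ (x≢y⇒x∉⁅y⁆ x≢y)) (cong suc (∣⁅x⁆∣≡1 y))))

⁅x⁆-injective : ∀ {x y : Fin n} → ⁅ x ⁆ ≡ ⁅ y ⁆ → x ≡ y
⁅x⁆-injective {x = x} {y} eq = x∈⁅y⁆⇒x≡y y (subst (x ∈_) eq (x∈⁅x⁆ x))

∈⁅x,y⁆⁻ : ∀ {x y z : Fin n} → z ∈ ⁅ x ⁆ ∪ ⁅ y ⁆ → z ≡ x ⊎ z ≡ y
∈⁅x,y⁆⁻ {x = x} {y} z∈ with x∈p∪q⁻ ⁅ x ⁆ ⁅ y ⁆ z∈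
... | inj₁ z∈x = inj₁ (x∈⁅y⁆⇒x≡y x z∈x)
... | inj₂ z∈y = inj₂ (x∈⁅y⁆⇒x≡y y z∈y)

x∈⁅x,y⁆ : ∀ (x y : Fin n) → x ∈ ⁅ x ⁆ ∪ ⁅ y ⁆
x∈⁅x,y⁆ x y = p⊆p∪q ⁅ y ⁆ (x∈⁅x⁆ x)

y∈⁅x,y⁆ : ∀ (x y : Fin n) → y ∈ ⁅ x ⁆ ∪ ⁅ y ⁆
y∈⁅x,y⁆ x y = q⊆p∪q ⁅ x ⁆ ⁅ y ⁆ (x∈⁅x⁆ y)

-- Ocd-sets with complement of size at most two, and the shape of ocd-sets

module _ (G : Graph n) where
  open Graph G

  adj⇒≢ : ∀ {u v} → Adj u v → u ≢ v
  adj⇒≢ uv refl = Adj-irr uv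

  ⊤-ocd : IsOCD G Subset.⊤
  ⊤-ocd = (λ v v∉⊤ → contradiction ∈⊤ v∉⊤) , inj₁ refl

  ∁⁅u⁆-ocd : ∀ {u w} → Adj u w → IsOCD G (∁ ⁅ u ⁆)
  ∁⁅u⁆-ocd {u} {w} uw = dominating ,
    inj₂ (subst (InducedConnected G) (sym (∁-involutive ⁅ u ⁆)) connected)
    where
    dominating : Dominating G (∁ ⁅ u ⁆)
    dominating v v∉ with refl ← x∈⁅y⁆⇒x≡y u (x∉∁p⇒x∈p v∉) =
      w , x∉p⇒x∈∁p (x≢y⇒x∉⁅y⁆ (adj⇒≢ uw ∘ sym)) , uw

    connected : InducedConnected G ⁅ u ⁆
    connected = (u , x∈⁅x⁆ u) , λ a b a∈ b∈ →
      subst (Star _ a) (trans (x∈⁅y⁆⇒x≡y u a∈) (sym (x∈⁅y⁆⇒x≡y u b∈))) ε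

  -- The vertices `u′` and `v′` lie off the edge `uv` and dominate its two ends. They may coincide,
  -- as in a triangle.
  ∁⁅u,v⁆-ocd : ∀ {u v u′ v′} → Adj u v → Adj u u′ → u′ ≢ v → Adj v v′ → v′ ≢ u →
               IsOCD G (∁ (⁅ u ⁆ ∪ ⁅ v ⁆))
  ∁⁅u,v⁆-ocd {u} {v} {u′} {v′} uv uu′ u′≢v vv′ v′≢u = dominating ,
    inj₂ (subst (InducedConnected G) (sym (∁-involutive (⁅ u ⁆ ∪ ⁅ v ⁆))) connected)
    where
    outer : ∀ {w} → w ≢ u → w ≢ v → w ∈ ∁ (⁅ u ⁆ ∪ ⁅ v ⁆)
    outer w≢u w≢v = x∉p⇒x∈∁p λ w∈ → [ w≢u , w≢v ]′ (∈⁅x,y⁆⁻ w∈)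

    dominating : Dominating G (∁ (⁅ u ⁆ ∪ ⁅ v ⁆))
    dominating w w∉ with ∈⁅x,y⁆⁻ (x∉∁p⇒x∈p w∉)
    ... | inj₁ refl = u′ , outer (adj⇒≢ uu′ ∘ sym) u′≢v , uu′
    ... | inj₂ refl = v′ , outer v′≢u (adj⇒≢ vv′ ∘ sym) , vv′

    connected : InducedConnected G (⁅ u ⁆ ∪ ⁅ v ⁆)
    connected = (u , x∈⁅x,y⁆ u v) , λ a b a∈ b∈ → path a∈ b∈ (∈⁅x,y⁆⁻ a∈) (∈⁅x,y⁆⁻ b∈)
      where
      path : ∀ {a b} → a ∈ ⁅ u ⁆ ∪ ⁅ v ⁆ → b ∈ ⁅ u ⁆ ∪ ⁅ v ⁆ →
             a ≡ u ⊎ a ≡ v → b ≡ u ⊎ b ≡ v → Star (InducedAdj G (⁅ u ⁆ ∪ ⁅ v ⁆)) a b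
      path a∈ b∈ (inj₁ refl) (inj₁ refl) = ε
      path a∈ b∈ (inj₁ refl) (inj₂ refl) = (a∈ , b∈ , uv) ◅ ε
      path a∈ b∈ (inj₂ refl) (inj₁ refl) = (a∈ , b∈ , Adj-sym uv) ◅ ε
      path a∈ b∈ (inj₂ refl) (inj₂ refl) = ε

  -- The graph induced by `T` has maximum degree at most one: its edges form a matching, and
  -- isolated vertices are allowed.
  InducedMatching : Subset n → Set
  InducedMatching T = ∀ {v a b} → InducedAdj G T v a → InducedAdj G T v b → a ≡ b

  -- A walk inside `T` starting at `u` can only go back and forth along the one edge at `u`, or
  -- cannot move at all if there is none.
  connected-matching : ∀ {T} → InducedMatching T → InducedConnected G T →
    (∃ λ u → T ≡ ⁅ u ⁆) ⊎ (∃ λ u → ∃ λ v → Adj u v × T ≡ ⁅ u ⁆ ∪ ⁅ v ⁆)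
  connected-matching {T} matching ((u , u∈T) , connected)
    with any? (inducedAdj? G T u)
  ... | no isolated = inj₁ (u , ⊆-antisym
          (λ {w} w∈T → stays (connected u w u∈T w∈T))
          (λ w∈⁅u⁆ → subst (_∈ T) (sym (x∈⁅y⁆⇒x≡y u w∈⁅u⁆)) u∈T))
    where
    stays : ∀ {w} → Star (InducedAdj G T) u w → w ∈ ⁅ u ⁆
    stays ε        = x∈⁅x⁆ u
    stays (uw ◅ _) = contradiction (_ , uw) isolated
  ... | yes (v , uv@(_ , v∈T , u~v)) = inj₂ (u , v , u~v , ⊆-antisym
          (λ {w} w∈T → stays (inj₁ refl) (connected u w u∈T w∈T))
          λ w∈ → [ (λ { refl → u∈T }) , (λ { refl → v∈T }) ]′ (∈⁅x,y⁆⁻ w∈))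
    where
    stays : ∀ {x w} → x ≡ u ⊎ x ≡ v → Star (InducedAdj G T) x w → w ∈ ⁅ u ⁆ ∪ ⁅ v ⁆
    stays (inj₁ refl) ε         = x∈⁅x,y⁆ u v
    stays (inj₂ refl) ε         = y∈⁅x,y⁆ u v
    stays (inj₁ refl) (uw ◅ ws) = stays (inj₂ (matching uw uv)) ws
    stays (inj₂ refl) (vw ◅ ws) = stays (inj₁ (matching vw (v∈T , u∈T , Adj-sym u~v))) ws

  data Shape (S : Subset n) : Set where
    full        : S ≡ Subset.⊤ → Shape S
    sans-vertex : ∀ u → S ≡ ∁ ⁅ u ⁆ → Shape S
    sans-edge   : ∀ u v → Adj u v → S ≡ ∁ (⁅ u ⁆ ∪ ⁅ v ⁆) → Shape S

  ocd-shape : (∀ {S} → Dominating G S → InducedMatching (∁ S)) → ∀ {S} → IsOCD G S → Shape S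
  ocd-shape matching (_ , inj₁ S≡⊤) = full S≡⊤
  ocd-shape matching {S} (dom , inj₂ connected) with connected-matching (matching dom) connected
  ... | inj₁ (u , eq)          = sans-vertex u (trans (sym (∁-involutive S)) (cong ∁ eq))
  ... | inj₂ (u , v , uv , eq) = sans-edge u v uv (trans (sym (∁-involutive S)) (cong ∁ eq))

-- Induction on `m` strips one leading zero from the list and passes from `d` to `d ∘ suc`.
shift-coeff : ∀ m (d : ℕ → ℕ) {a b c} → d m ≡ a → d (suc m) ≡ b → d (2+ m) ≡ c →
  (∀ {k} → k ≢ m → k ≢ suc m → k ≢ 2+ m → d k ≡ 0) →
  ∀ k → + d k ≡ coeff (shift m (+ a ∷ + b ∷ + c ∷ [])) k
shift-coeff zero    d da db dc rest zero                = cong +_ da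
shift-coeff zero    d da db dc rest (suc zero)          = cong +_ db
shift-coeff zero    d da db dc rest (suc (suc zero))    = cong +_ dc
shift-coeff zero    d da db dc rest (suc (suc (suc k))) =
  cong +_ (rest (λ ()) (λ ()) (λ ()))
shift-coeff (suc m) d da db dc rest zero                = cong +_ (rest (λ ()) (λ ()) (λ ()))
shift-coeff (suc m) d da db dc rest (suc k)             =
  shift-coeff m (d ∘ suc) da db dc
    (λ p q r → rest (p ∘ ℕ.suc-injective) (q ∘ ℕ.suc-injective) (r ∘ ℕ.suc-injective)) k

-- Graphs in which complements of dominating sets induce matchings

module _ (G : Graph (2+ m))
  (matching : ∀ {S} → Dominating G S → InducedMatching G (∁ S))
  (neighbour : ∀ u → ∃ λ w → Graph.Adj G u w) where

  -- The three shapes have the distinct sizes `2+ m`, `suc m` and `m`, so size determines shape.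
  -- There is one full set, and each of the `2+ m` vertices can be omitted because it has a
  -- neighbour; only the number of omissible edges depends on the graph.
  D̃-matching : d̃ G m ≡ c → D̃ G ≈ₚ shift m (+ c ∷ + 2+ m ∷ + 1 ∷ [])
  D̃-matching d̃m≡c k = trans (coeff-D̃ G k) (shift-coeff m (d̃ G) d̃m≡c
    (d̃-enumeration G (λ u → ∁ ⁅ u ⁆) (⁅x⁆-injective ∘ ∁-injective)
      (λ u → ∁⁅u⁆-ocd G (proj₂ (neighbour u))) ∣∁⁅x⁆∣ complete₁)
    (d̃-enumeration G {c = 1} (λ _ → Subset.⊤) (λ { {zero} {zero} _ → refl })
      (λ _ → ⊤-ocd G) (λ _ → ∣⊤∣≡n (2+ m)) (λ _ ∣S∣≡n → zero , ∣p∣≡n⇒p≡⊤ ∣S∣≡n))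
    (λ k≢m k≢1+m k≢2+m → d̃≡0 G (rest k≢m k≢1+m k≢2+m)) k)
    where
    complete₁ : ∀ {S} → IsOCD G S → ∣ S ∣ ≡ suc m → ∃ λ u → S ≡ ∁ ⁅ u ⁆
    complete₁ {S} S-ocd ∣S∣≡1+m = go (ocd-shape G matching S-ocd)
      where
      go : Shape G S → ∃ λ u → S ≡ ∁ ⁅ u ⁆
      go (full refl)             = contradiction (trans (sym (∣⊤∣≡n (2+ m))) ∣S∣≡1+m) ℕ.1+n≢n
      go (sans-vertex u S≡)      = u , S≡
      go (sans-edge u v uv refl) =
        contradiction (trans (sym ∣S∣≡1+m) (∣∁⁅x,y⁆∣ (adj⇒≢ G uv))) ℕ.1+n≢n

    rest : ∀ {k} → k ≢ m → k ≢ suc m → k ≢ 2+ m → ∀ {S} → IsOCD G S → ∣ S ∣ ≢ k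
    rest {k} k≢m k≢1+m k≢2+m {S} S-ocd ∣S∣≡k = go (ocd-shape G matching S-ocd)
      where
      go : ¬ Shape G S
      go (full refl)             = k≢2+m (trans (sym ∣S∣≡k) (∣⊤∣≡n _))
      go (sans-vertex u refl)    = k≢1+m (trans (sym ∣S∣≡k) (∣∁⁅x⁆∣ u))
      go (sans-edge u v uv refl) = k≢m (trans (sym ∣S∣≡k) (∣∁⁅x,y⁆∣ (adj⇒≢ G uv)))

  sans-edge-shape : ∀ {S} → IsOCD G S → ∣ S ∣ ≡ m →
    ∃ λ u → ∃ λ v → Graph.Adj G u v × S ≡ ∁ (⁅ u ⁆ ∪ ⁅ v ⁆)
  sans-edge-shape S-ocd ∣S∣≡m with ocd-shape G matching S-ocd
  ... | full refl             = contradiction (trans (sym (∣⊤∣≡n (2+ m))) ∣S∣≡m) (ℕ.m+1+n≢n 1)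
  ... | sans-vertex u refl    = contradiction (trans (sym (∣∁⁅x⁆∣ u)) ∣S∣≡m) ℕ.1+n≢n
  ... | sans-edge u v uv S≡   = u , v , uv , S≡

-- Paths and cycles

-- Such an `R` orients the edges of a graph of maximum degree two, with at most one edge leaving and
-- at most one entering each vertex. Asymmetry excludes loops and ensures that each edge has only
-- one direction.
record IsPartialBijection {A : Set} (R : Rel A 0ℓ) : Set where
  field
    functional : ∀ {i j k} → R i j → R i k → j ≡ k
    injective  : ∀ {i j k} → R i k → R j k → i ≡ j
    asymmetric : ∀ {i j} → R i j → ¬ R j i

-- An edge whose complement is an ocd-set is the middle of an R-path of length
-- three; a, b, c and d enumerate these R-paths.
module _ (G : Graph (2+ m)) (R : Rel (Fin (2+ m)) 0ℓ) (pb : IsPartialBijection R)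
  (adj⁺ : ∀ {i j} → R i j ⊎ R j i → Graph.Adj G i j)
  (adj⁻ : ∀ {i j} → Graph.Adj G i j → R i j ⊎ R j i)
  (neighbour : ∀ u → ∃ λ w → Graph.Adj G u w)
  (a b c d : Fin k → Fin (2+ m))
  (R-ab : ∀ i → R (a i) (b i)) (R-bc : ∀ i → R (b i) (c i)) (R-cd : ∀ i → R (c i) (d i))
  (b-injective : ∀ {i j} → b i ≡ b j → i ≡ j)
  (complete : ∀ {w x y z} → R w x → R x y → R y z → ∃ λ i → b i ≡ x) where

  open IsPartialBijection pb

  private
    -- Pigeonhole: `v` has the neighbours `x`, `y` and `u`, and two of them lie on the same side of
    -- `v` along `R`, hence coincide. As `u` is in `S` and the others are not, these are `x` and
    -- `y`.
    matching : ∀ {S} → Dominating G S → InducedMatching G (∁ S)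
    matching {S} dom {v} {x} {y} (v∈ , x∈ , vx) (_ , y∈ , vy)
      with u , u∈S , vu ← dom v (x∈∁p⇒x∉p v∈) = go (adj⁻ vx) (adj⁻ vy) (adj⁻ vu)
      where
      u≢ : ∀ {w} → w ∈ ∁ S → u ≢ w
      u≢ w∈ refl = x∈∁p⇒x∉p w∈ u∈S

      go : R v x ⊎ R x v → R v y ⊎ R y v → R v u ⊎ R u v → x ≡ y
      go (inj₁ p) (inj₁ q) _        = functional p q
      go (inj₂ p) (inj₂ q) _        = injective p q
      go (inj₁ p) (inj₂ q) (inj₁ r) = contradiction (functional r p) (u≢ x∈)
      go (inj₁ p) (inj₂ q) (inj₂ r) = contradiction (injective r q) (u≢ y∈)
      go (inj₂ p) (inj₁ q) (inj₁ r) = contradiction (functional r q) (u≢ y∈)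
      go (inj₂ p) (inj₁ q) (inj₂ r) = contradiction (injective r p) (u≢ x∈)

    edge : Fin k → Subset (2+ m)
    edge i = ⁅ b i ⁆ ∪ ⁅ c i ⁆

    edge-injective : ∀ {i j} → edge i ≡ edge j → i ≡ j
    edge-injective {i} {j} eq
      with ∈⁅x,y⁆⁻ (subst (b i ∈_) eq (x∈⁅x,y⁆ (b i) (c i)))
         | ∈⁅x,y⁆⁻ (subst (b j ∈_) (sym eq) (x∈⁅x,y⁆ (b j) (c j)))
    ... | inj₁ bi≡bj | _          = b-injective bi≡bj
    ... | inj₂ _     | inj₁ bj≡bi = b-injective (sym bj≡bi)
    -- The two edges would be a single edge traversed in opposite directions.
    ... | inj₂ bi≡cj | inj₂ bj≡ci = contradiction
            (subst (R (b j)) (sym bi≡cj) (R-bc j))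
            (asymmetric (subst (R (b i)) (sym bj≡ci) (R-bc i)))

    edge-ocd : ∀ i → IsOCD G (∁ (edge i))
    edge-ocd i = ∁⁅u,v⁆-ocd G (adj⁺ (inj₁ (R-bc i)))
      (adj⁺ (inj₂ (R-ab i))) (λ a≡c → asymmetric (R-bc i) (subst (λ x → R x (b i)) a≡c (R-ab i)))
      (adj⁺ (inj₁ (R-cd i))) (λ d≡b → asymmetric (R-bc i) (subst (R (c i)) d≡b (R-cd i)))

    -- The successor of `u` is `v`, which is not in `S`, so `u` is dominated by its predecessor;
    -- likewise `v` is dominated by its successor. Together the four vertices form a chain.
    edge-complete : ∀ {S u v} → IsOCD G S → R u v → S ≡ ∁ (⁅ u ⁆ ∪ ⁅ v ⁆) → ∃ λ i → S ≡ ∁ (edge i)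
    edge-complete {u = u} {v} (dom , _) uv refl
      with dom u (x∈p⇒x∉∁p (x∈⁅x,y⁆ u v)) | dom v (x∈p⇒x∉∁p (y∈⁅x,y⁆ u v))
    ... | w , w∈S , u~w | w′ , w′∈S , v~w′ with adj⁻ u~w | adj⁻ v~w′
    ...   | inj₁ uw | _ with refl ← functional uv uw = contradiction w∈S (x∈p⇒x∉∁p (y∈⁅x,y⁆ u v))
    ...   | inj₂ wu | inj₂ w′v with refl ← injective uv w′v = contradiction w′∈S (x∈p⇒x∉∁p (x∈⁅x,y⁆ u v))
    ...   | inj₂ wu | inj₁ vw′ with i , refl ← complete wu uv vw′
                               with refl ← functional uv (R-bc i) = i , refl

  D̃-chains : D̃ G ≈ₚ shift m (+ k ∷ + 2+ m ∷ + 1 ∷ [])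
  D̃-chains = D̃-matching G matching neighbour
    (d̃-enumeration G (∁ ∘ edge) (edge-injective ∘ ∁-injective) edge-ocd
      (λ i → ∣∁⁅x,y⁆∣ (adj⇒≢ G (adj⁺ (inj₁ (R-bc i))))) complete′)
    where
    complete′ : ∀ {S} → IsOCD G S → ∣ S ∣ ≡ m → ∃ λ i → S ≡ ∁ (edge i)
    complete′ S-ocd ∣S∣≡m with u , v , u~v , S≡ ← sans-edge-shape G matching neighbour S-ocd ∣S∣≡m
                          with adj⁻ u~v
    ... | inj₁ uv = edge-complete S-ocd uv S≡
    ... | inj₂ vu = edge-complete S-ocd vu (trans S≡ (cong ∁ (∪-comm ⁅ u ⁆ ⁅ v ⁆)))

-- Coefficient lists of the bracketed factors

quadratic : ∀ n a → X ^ₚ 2 +ₚ const n *ₚ X +ₚ const a ≈ₚ a ∷ n ∷ + 1 ∷ []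
quadratic n a zero          rewrite ℤ.*-zeroʳ n = ℤ.+-identityˡ a
quadratic n a (suc zero)    = trans (ℤ.+-identityˡ _) (ℤ.*-identityʳ n)
quadratic n a (suc (suc k)) = refl

linear : ∀ n → const (+ n) +ₚ X +ₚ const (+ 1) ≈ₚ + suc n ∷ + 1 ∷ []
linear n zero    = cong +_ (trans (cong (ℕ._+ 1) (ℕ.+-identityʳ n)) (ℕ.+-comm n 1))
linear n (suc k) = refl

-- Paths: runs of four consecutive vertices

path-partialBijection : IsPartialBijection (PathSucc {n})
path-partialBijection = record
  { functional = λ ij ik → toℕ-injective (trans ij (sym ik))
  ; injective  = λ ik jk → toℕ-injective (ℕ.suc-injective (trans (sym ik) jk))
  ; asymmetric = λ ij ji → ℕ.m+1+n≢n 1 (sym (trans ij (cong suc ji)))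
  }

suc-inject₁ : (i : Fin n) → PathSucc (inject₁ i) (suc i)
suc-inject₁ i = cong suc (sym (toℕ-inject₁ i))

D̃-path : ∀ l .{{n≢0 : NonZero (2+ (2+ l))}} → D̃ (pathGraph (2+ (2+ l)) {{n≢0}}) ≈ₚ
  shift (2+ l) (+ suc l ∷ + 2+ (2+ l) ∷ + 1 ∷ [])
D̃-path l {{n≢0}} = D̃-chains (pathGraph (2+ (2+ l)) {{n≢0}})
  PathSucc path-partialBijection id id neighbour
  -- Chain `i` consists of the vertices numbered `i`, `i + 1`, `i + 2` and `i + 3`. With `4 + l`
  -- vertices, `i` ranges over `Fin (suc l)`.
  (λ i → inject₁ (inject₁ (inject₁ i))) (λ i → suc (inject₁ (inject₁ i)))
  (λ i → suc (suc (inject₁ i))) (λ i → suc (suc (suc i)))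
  (λ i → suc-inject₁ (inject₁ (inject₁ i)))
  (λ i → cong suc (suc-inject₁ (inject₁ i)))
  (λ i → cong suc (cong suc (suc-inject₁ i)))
  (λ eq → inject₁-injective (inject₁-injective (suc-injective eq)))
  complete
  where
  neighbour : ∀ u → ∃ λ w → Graph.Adj (pathGraph (2+ (2+ l)) {{n≢0}}) u w
  neighbour zero    = suc zero , inj₁ refl
  neighbour (suc i) = inject₁ i , inj₂ (suc-inject₁ i)

  complete : ∀ {w x y z : Fin (2+ (2+ l))} → PathSucc w x → PathSucc x y → PathSucc y z →
             ∃ λ (i : Fin (suc l)) → suc (inject₁ (inject₁ i)) ≡ x
  complete {w} {z = z} wx xy yz = fromℕ< w<1+l , toℕ-injective (begin
    suc (toℕ (inject₁ (inject₁ (fromℕ< w<1+l)))) ≡⟨ cong suc (toℕ-inject₁ _) ⟩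
    suc (toℕ (inject₁ (fromℕ< w<1+l)))           ≡⟨ cong suc (toℕ-inject₁ _) ⟩
    suc (toℕ (fromℕ< w<1+l))                     ≡⟨ cong suc (toℕ-fromℕ< w<1+l) ⟩
    suc (toℕ w)                                  ≡⟨ wx ⟨
    _                                            ∎)
    where
    open ≡-Reasoning
    w<1+l : toℕ w < suc l
    -- The last vertex `z` has number `3 + w`, which is below `4 + l`.
    w<1+l = ℕ.+-cancelˡ-< 3 _ _ (subst (_< 2+ (2+ l))
      (trans yz (cong suc (trans xy (cong suc wx)))) (toℕ<n z))

-- Cycles: a chain around every vertex

module _ {n} (3≤n : 3 ≤ n) where

  -- The wrap-around step leaves the last vertex and enters vertex `0`, and no ordinary step does
  -- either. For asymmetry, two opposite steps would force `n` to be 2 if one of them wraps around,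
  -- and 1 if both do.
  cycle-partialBijection : IsPartialBijection (CycleSucc {n})
  cycle-partialBijection = record
    { functional = functional ; injective = injective ; asymmetric = asymmetric }
    where
    no-suc : ∀ {i j : Fin n} → PathSucc i j → suc (toℕ i) ≢ n
    no-suc {j = j} ij 1+i≡n = ℕ.<⇒≢ (toℕ<n j) (trans ij 1+i≡n)

    functional : ∀ {i j k : Fin n} → CycleSucc i j → CycleSucc i k → j ≡ k
    functional (inj₁ ij)        (inj₁ ik)        = toℕ-injective (trans ij (sym ik))
    functional (inj₁ ij)        (inj₂ (i≡n , _)) = contradiction i≡n (no-suc ij)
    functional (inj₂ (i≡n , _)) (inj₁ ik)        = contradiction i≡n (no-suc ik)
    functional (inj₂ (_ , j≡0)) (inj₂ (_ , k≡0)) = toℕ-injective (trans j≡0 (sym k≡0))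

    injective : ∀ {i j k : Fin n} → CycleSucc i k → CycleSucc j k → i ≡ j
    injective (inj₁ ik)        (inj₁ jk)        =
      toℕ-injective (ℕ.suc-injective (trans (sym ik) jk))
    injective (inj₁ ik)        (inj₂ (_ , k≡0)) = contradiction (trans (sym ik) k≡0) ℕ.1+n≢0
    injective (inj₂ (_ , k≡0)) (inj₁ jk)        = contradiction (trans (sym jk) k≡0) ℕ.1+n≢0
    injective (inj₂ (i≡n , _)) (inj₂ (j≡n , _)) =
      toℕ-injective (ℕ.suc-injective (trans i≡n (sym j≡n)))

    n≢2 : ∀ {i j : Fin n} → PathSucc i j → toℕ i ≡ 0 → suc (toℕ j) ≢ n
    n≢2 ij i≡0 j≡n = ℕ.<⇒≢ 3≤n (trans (cong suc (sym (trans ij (cong suc i≡0)))) j≡n)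

    asymmetric : ∀ {i j : Fin n} → CycleSucc i j → ¬ CycleSucc j i
    asymmetric (inj₁ ij) (inj₁ ji) = ℕ.m+1+n≢n 1 (sym (trans ij (cong suc ji)))
    asymmetric (inj₁ ij) (inj₂ (j≡n , i≡0)) = n≢2 ij i≡0 j≡n
    asymmetric (inj₂ (i≡n , j≡0)) (inj₁ ji) = n≢2 ji j≡0 i≡n
    asymmetric (inj₂ (i≡n , _)) (inj₂ (_ , i≡0)) =
      ℕ.<⇒≢ (ℕ.<-trans (s≤s (s≤s z≤n)) 3≤n) (trans (cong suc (sym i≡0)) i≡n)

cycle-suc : ∀ (i : Fin (suc n)) → ∃ λ j → CycleSucc i j
cycle-suc {n} i with suc (toℕ i) ℕ.<? suc n
... | yes 1+i<n = fromℕ< 1+i<n , inj₁ (toℕ-fromℕ< 1+i<n)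
... | no  1+i≮n = zero , inj₂ (ℕ.≤-antisym (toℕ<n i) (ℕ.≮⇒≥ 1+i≮n) , refl)

cycle-pred : ∀ (i : Fin (suc n)) → ∃ λ j → CycleSucc j i
cycle-pred {n} zero = fromℕ n , inj₂ (cong suc (toℕ-fromℕ n) , refl)
cycle-pred (suc i)  = inject₁ i , inj₁ (suc-inject₁ i)

D̃-cycle : ∀ m (n≥3 : 3 ≤ 2+ m) → D̃ (cycleGraph (2+ m) n≥3) ≈ₚ
  shift m (+ 2+ m ∷ + 2+ m ∷ + 1 ∷ [])
D̃-cycle m n≥3 = D̃-chains (cycleGraph (2+ m) n≥3) CycleSucc (cycle-partialBijection n≥3) id id
  (λ u → proj₁ (cycle-suc u) , inj₁ (proj₂ (cycle-suc u)))
  -- Chains are indexed by their second vertex, which makes injectivity and completeness immediate.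
  -- For three vertices the first and last vertex of a chain coincide.
  (proj₁ ∘ cycle-pred) id next (next ∘ next)
  (proj₂ ∘ cycle-pred) (proj₂ ∘ cycle-suc) (proj₂ ∘ cycle-suc ∘ next)
  id (λ {_} {x} _ _ _ → x , refl)
  where
  next : Fin (2+ m) → Fin (2+ m)
  next = proj₁ ∘ cycle-suc

-- Stars: no edge can be omitted

D̃-star : ∀ m → D̃ (starGraph (suc m)) ≈ₚ shift m (+ 0 ∷ + 2+ m ∷ + 1 ∷ [])
D̃-star m = D̃-matching (starGraph (suc m)) matching neighbour {c = 0}
  (d̃≡0 (starGraph (suc m)) {k = m} λ S-ocd ∣S∣≡m →
    no-edge S-ocd (sans-edge-shape (starGraph (suc m)) matching neighbour S-ocd ∣S∣≡m))
  where
  -- The centre is the only neighbour of a leaf, so a leaf outside `S` forces the centre into `S`.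
  leaf : ∀ S → Dominating (starGraph (suc m)) S → ∀ i → suc i ∈ ∁ S → zero ∉ ∁ S
  leaf S dom i i∈ 0∈ with dom (suc i) (x∈∁p⇒x∉p i∈)
  ... | zero , 0∈S , _ = x∈∁p⇒x∉p 0∈ 0∈S

  independent : ∀ S → Dominating (starGraph (suc m)) S →
    ∀ {u v} → ¬ InducedAdj (starGraph (suc m)) (∁ S) u v
  independent S dom {zero}  {suc i} (0∈ , i∈ , _) = leaf S dom i i∈ 0∈
  independent S dom {suc i} {zero}  (i∈ , 0∈ , _) = leaf S dom i i∈ 0∈

  matching : ∀ {S} → Dominating (starGraph (suc m)) S → InducedMatching (starGraph (suc m)) (∁ S)
  -- Vacuous, since the complement of a dominating set of a star contains no edge.
  matching {S} dom {v} {a} va _ = contradiction va (independent S dom {v} {a})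

  neighbour : ∀ u → ∃ λ w → Graph.Adj (starGraph (suc m)) u w
  neighbour zero    = suc zero , tt
  neighbour (suc _) = zero , tt

  no-edge : ∀ {S} → IsOCD (starGraph (suc m)) S →
    ¬ ∃ λ u → ∃ λ v → Graph.Adj (starGraph (suc m)) u v × S ≡ ∁ (⁅ u ⁆ ∪ ⁅ v ⁆)
  no-edge (dom , _) (u , v , uv , refl) = independent (∁ (⁅ u ⁆ ∪ ⁅ v ⁆)) dom {u} {v}
    ( subst (u ∈_) (sym (∁-involutive _)) (x∈⁅x,y⁆ u v)
    , subst (v ∈_) (sym (∁-involutive _)) (y∈⁅x,y⁆ u v) , uv)

-- The factored formulas for paths, cycles and stars

theorem5 : (∀ (n : ℕ) .{{_ : NonZero n}} → 4 ≤ n →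
    D̃ (pathGraph n) ≈ₚ X ^ₚ (n ∸ 2) *ₚ (X ^ₚ 2 +ₚ const (+ n) *ₚ X +ₚ const (+ n - + 3)))
    × (∀ (n : ℕ) (n≥3 : 3 ≤ n) →
    D̃ (cycleGraph n n≥3) ≈ₚ X ^ₚ (n ∸ 2) *ₚ (X ^ₚ 2 +ₚ const (+ n) *ₚ X +ₚ const (+ n)))
    × (∀ (n : ℕ) → 1 ≤ n →
    D̃ (starGraph n) ≈ₚ X ^ₚ n *ₚ (const (+ n) +ₚ X +ₚ const (+ 1)))
theorem5 = path , cycle , star
  where
  path : ∀ n .{{_ : NonZero n}} → 4 ≤ n → D̃ (pathGraph n) ≈ₚ
    X ^ₚ (n ∸ 2) *ₚ (X ^ₚ 2 +ₚ const (+ n) *ₚ X +ₚ const (+ n - + 3))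
  path n@(2+ (2+ l)) {{n≢0}} (s≤s (s≤s (s≤s (s≤s _)))) =
    -- For `n` equal to `4 + l`, the integer `+ n - + 3` computes to `+ suc l`, the number of
    -- chains.
    factor (2+ l) (D̃ (pathGraph n {{n≢0}})) (X ^ₚ 2 +ₚ const (+ n) *ₚ X +ₚ const (+ n - + 3))
      (+ suc l ∷ + n ∷ + 1 ∷ []) (D̃-path l {{n≢0}}) (quadratic (+ n) (+ suc l))

  cycle : ∀ n (n≥3 : 3 ≤ n) → D̃ (cycleGraph n n≥3) ≈ₚ
    X ^ₚ (n ∸ 2) *ₚ (X ^ₚ 2 +ₚ const (+ n) *ₚ X +ₚ const (+ n))
  cycle (suc zero) (s≤s ())
  cycle n@(2+ m)   n≥3 =
    factor m (D̃ (cycleGraph n n≥3)) (X ^ₚ 2 +ₚ const (+ n) *ₚ X +ₚ const (+ n))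
      (+ n ∷ + n ∷ + 1 ∷ []) (D̃-cycle m n≥3) (quadratic (+ n) (+ n))

  star : ∀ n → 1 ≤ n → D̃ (starGraph n) ≈ₚ X ^ₚ n *ₚ (const (+ n) +ₚ X +ₚ const (+ 1))
  star n@(suc m) _ =
    factor n (D̃ (starGraph n)) (const (+ n) +ₚ X +ₚ const (+ 1)) (+ suc n ∷ + 1 ∷ [])
      -- The zero count of omissible edges heads the list of `D̃-star`; it is absorbed into one more
      -- power of `X`, raising the exponent from `m` to `n`.
      (subst (D̃ (starGraph n) ≈ₚ_) (sym (shift-suc m (+ suc n ∷ + 1 ∷ []))) (D̃-star m)) (linear n)
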